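{- Let $N = p^k m^2$ be an odd perfect number, where $p$ is a prime with $p \equiv k \equiv 1 \pmod 4$, $k$ a positive integer, $m$ a positive integer and $\gcd(p,m)=1$. Set $$\rho_1 = \frac{\sigma(p^k)}{p^k},\quad \rho_2 = \frac{\sigma(p^k)}{m^2},\quad \mu_1 = \frac{\sigma(m^2)}{m^2},\quad \mu_2 = \frac{\sigma(m^2)}{p^k}.$$ Then $$0 < \rho_2 \le \frac{2}{3} < 1 < \rho_1 < \frac{5}{4} < \frac{8}{5} < \mu_1 < 2 < 3 \le \mu_2$$ and $$\frac{57}{20} < \rho_1 + \mu_1 < 3 < \frac{11}{3} \le \rho_2 + \mu_2.$$
   Context: $\sigma(n)$ denotes the sum of the positive divisors of $n$. An odd perfect number is an odd positive integer $N$ with $\sigma(N)=2N$. -}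

module Defs where

open import Data.Nat using (ℕ; zero; suc; _+_)
open import Data.Nat.Divisibility using (_∣?_)
open import Data.List using (List; filter; map; upTo)
open import Data.Nat.ListAction using (sum)
open import Data.Integer using (+_)
open import Data.Rational using (ℚ; _/_; 0ℚ)

divisors : ℕ → List ℕ
divisors n = filter (_∣? n) (map suc (upTo n))

σ : ℕ → ℕ
σ n = sum (divisors n)

-- a / b as a rational number; only used with b ≥ 1 (value 0 for b = 0 is a dummy)
_÷_ : ℕ → ℕ → ℚ
a ÷ zero = 0ℚ
a ÷ suc b = (+ a) / suc b

infixl 7 _÷_

{-# OPTIONS --safe #-}

-- Write q = p^k.  As q is prime to σ(q) and σ(q) σ(m²) = 2 q m², there is s with σ(m²) = s q and
-- σ(q) s = 2 m²; all four ratios are then controlled by s and by 1 < σ(q)/q < 5/4, and everything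
-- rests on s ≥ 3.  Since σ(q) is even and m is odd, s ≠ 2.  If s = 1, then for r^(2a) ∥ m² the
-- factor σ(r^(2a)) of σ(m²) = p^k is a power x of p, and x − 1 is divisible by r exactly once.
-- As r^(2a) divides σ(p^k), hence x^(k+1) − 1, lifting the exponent gives r^(2a−1) ∣ k + 1.
-- So m ∣ k + 1, and p^k < σ(p^k) = 2 m² ≤ 2 (k + 1)² leaves only k = 1, m = 1, which is absurd.

module Submission where

open import Defs
open import Data.Nat using (ℕ; _*_; _^_; _%_)
open import Data.Nat.Primality using (Prime)
open import Data.Nat.GCD using (gcd)
open import Data.Product using (_×_)
open import Relation.Binary.PropositionalEquality using (_≡_)

module NumberTheory where

  open import Data.Nat using (zero; suc; _+_; _∸_; _≤_; _<_; z≤n; s≤s; s≤s⁻¹; NonZero; ≢-nonZero; ≢-nonZero⁻¹; >-nonZero)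
  open import Data.Nat.Properties
  open import Data.Nat.DivMod using (_/_; m≡m%n+[m/n]*n)
  open import Data.Nat.Divisibility
  open import Data.Nat.Primality
  open import Data.Nat.Coprimality using (Coprime; coprime-divisor)
  import Data.Nat.Coprimality as Coprimality
  open import Data.Nat.Induction using (<-rec)
  open import Data.Nat.Primality.Factorisation using (factorise)
  open import Data.Nat.ListAction using (sum)
  open import Data.Nat.ListAction.Properties using (sum-++; sum-↭)
  open import Data.Nat.Tactic.RingSolver using (solve-∀)
  open import Data.List using ([]; _∷_; _++_; map; upTo)
  open import Data.List.Membership.Propositional using (_∈_)
  open import Data.List.Membership.Propositional.Properties
  open import Data.List.Membership.Propositional.Properties.WithK using (unique∧set⇒bag)
  open import Data.List.Relation.Binary.BagAndSetEquality using (∼bag⇒↭)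
  open import Data.List.Relation.Unary.All using (_∷_)
  open import Data.List.Relation.Unary.Unique.Propositional using (Unique)
  import Data.List.Relation.Unary.Unique.Propositional.Properties as Unique
  open import Data.Product using (∃; ∃₂; _,_; proj₁; proj₂)
  open import Data.Empty using (⊥)
  open import Data.Sum using (inj₁; inj₂; [_,_])
  open import Function using (_∘_; mk⇔)
  open import Relation.Nullary using (¬_; yes; no; contradiction)
  open import Relation.Binary.PropositionalEquality using (_≢_; refl; sym; trans; cong; cong₂; subst; module ≡-Reasoning)

  -- Primes and prime powers

  prime≢1 : ∀ {r} → Prime r → r ≢ 1
  prime≢1 pr refl = ¬prime[1] pr

  prime∣prime⇒≡ : ∀ {r p} → Prime r → Prime p → r ∣ p → r ≡ p
  prime∣prime⇒≡ pr pp r∣p with prime⇒irreducible pp r∣p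
  ... | inj₁ r≡1 = contradiction r≡1 (prime≢1 pr)
  ... | inj₂ r≡p = r≡p

  prime∤⇒coprime : ∀ {r n} → Prime r → r ∤ n → Coprime r n
  prime∤⇒coprime pr r∤n (d∣r , d∣n) with prime⇒irreducible pr d∣r
  ... | inj₁ d≡1 = d≡1
  ... | inj₂ refl = contradiction d∣n r∤n

  coprime-* : ∀ {a b n} → Coprime a n → Coprime b n → Coprime (a * b) n
  coprime-* ca cb (d∣ab , d∣n) =
    cb (coprime-divisor (λ (e∣d , e∣a) → ca (e∣a , ∣-trans e∣d d∣n)) d∣ab , d∣n)

  coprime-^ : ∀ {a n} e → Coprime a n → Coprime (a ^ e) n
  coprime-^ zero    _ = λ (d∣1 , _) → ∣1⇒≡1 d∣1
  coprime-^ (suc e) c = coprime-* c (coprime-^ e c)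

  prime^∤⇒coprime : ∀ {r n} e → Prime r → r ∤ n → Coprime (r ^ e) n
  prime^∤⇒coprime e pr r∤n = coprime-^ e (prime∤⇒coprime pr r∤n)

  coprime-∣-* : ∀ {a b n} → Coprime a b → a ∣ n → b ∣ n → a * b ∣ n
  coprime-∣-* {a} c a∣n (divides q refl) =
    *-monoˡ-∣ _ (coprime-divisor {o = q} c (subst (a ∣_) (*-comm q _) a∣n))

  ∣p^⇒≡p^ : ∀ {p} → Prime p → ∀ k {d} → d ∣ p ^ k → ∃ λ b → d ≡ p ^ b
  ∣p^⇒≡p^ pp zero d∣1 = 0 , ∣1⇒≡1 d∣1
  ∣p^⇒≡p^ {p} pp (suc k) {d} d∣ with p ∣? d
  ... | no p∤d = ∣p^⇒≡p^ pp k (coprime-divisor (Coprimality.sym (prime∤⇒coprime pp p∤d)) d∣)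
  ... | yes (divides e refl)
    with b , refl ← ∣p^⇒≡p^ pp k {e} (*-cancelˡ-∣ p {{prime⇒nonZero pp}} (subst (_∣ p * p ^ k) (*-comm e p) d∣))
    = suc b , *-comm (p ^ b) p

  extract : ∀ {r} → Prime r → ∀ m → .{{NonZero m}} → ∃₂ λ a m′ → m ≡ r ^ a * m′ × r ∤ m′
  extract {r} pr = <-rec (λ m → .{{NonZero m}} → ∃₂ λ a m′ → m ≡ r ^ a * m′ × r ∤ m′) step
    where
    step : ∀ m → (∀ {n} → n < m → .{{NonZero n}} → ∃₂ λ a m′ → n ≡ r ^ a * m′ × r ∤ m′) →
           .{{NonZero m}} → ∃₂ λ a m′ → m ≡ r ^ a * m′ × r ∤ m′
    step m rec with r ∣? m
    ... | no r∤m = 0 , m , sym (*-identityˡ m) , r∤m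
    ... | yes r∣m
      with a , m′ , eq , r∤m′ ← rec (quotient-< r∣m {{prime⇒nonTrivial pr}}) {{quotient≢0 r∣m}}
      = suc a , m′ , trans (m∣n⇒n≡m*quotient r∣m) (trans (cong (r *_) eq) (sym (*-assoc r (r ^ a) m′))) , r∤m′

  primeDivisor : ∀ m → .{{NonZero m}} → m ≢ 1 → ∃ λ r → Prime r × r ∣ m
  primeDivisor m m≢1 with factorise m
  ... | record { factors = [] ; isFactorisation = eq } = contradiction eq m≢1
  ... | record { factors = r ∷ rs ; isFactorisation = refl ; factorsPrime = pr ∷ _ } = r , pr , m∣m*n _

  -- Strong induction on `m`: the full power of one prime is split off, and being coprime to the
  -- cofactor it can be recombined with it. This lets `m ∣ suc k` be checked one prime at a time.
  primePowers⇒∣ : ∀ n m → .{{NonZero m}} → (∀ r e → Prime r → r ^ e ∣ m → r ^ e ∣ n) → m ∣ n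
  primePowers⇒∣ n = <-rec (λ m → .{{NonZero m}} → (∀ r e → Prime r → r ^ e ∣ m → r ^ e ∣ n) → m ∣ n) step
    where
    step : ∀ m → (∀ {m′} → m′ < m → .{{NonZero m′}} → (∀ r e → Prime r → r ^ e ∣ m′ → r ^ e ∣ n) → m′ ∣ n) →
           .{{NonZero m}} → (∀ r e → Prime r → r ^ e ∣ m → r ^ e ∣ n) → m ∣ n
    step m rec h with m ≟ 1
    ... | yes refl = 1∣ n
    ... | no m≢1 with r , pr , r∣m ← primeDivisor m m≢1 with extract pr m
    ...   | zero , m′ , refl , r∤m′ = contradiction (subst (r ∣_) (*-identityˡ m′) r∣m) r∤m′
    ...   | suc a , m′ , refl , r∤m′ =
      coprime-∣-* (prime^∤⇒coprime (suc a) pr r∤m′) (h r (suc a) pr (m∣m*n m′))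
        (rec m′<m {{m′≢0}} (λ r′ e pr′ d → h r′ e pr′ (∣n⇒∣m*n (r ^ suc a) d)))
      where
      m′∣m : m′ ∣ r ^ suc a * m′
      m′∣m = n∣m*n (r ^ suc a)
      m′≢0 : NonZero m′
      m′≢0 = m*n≢0⇒n≢0 (r ^ suc a)
      m′<m : m′ < r ^ suc a * m′
      m′<m = ≤∧≢⇒< (∣⇒≤ m′∣m) λ eq → r∤m′ (subst (r ∣_) (sym eq) r∣m)

  -- Geometric sums

  -- The sum 1 + x + ... + x^(n-1), with `n` terms, in Horner form. It stands for (x^n - 1)/(x - 1)
  -- without subtraction or division, and `geom p (suc k)` is σ(p^k) for a prime `p`.
  geom : ℕ → ℕ → ℕ
  geom x zero    = 0
  geom x (suc n) = 1 + x * geom x n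

  geom-+ : ∀ x m n → geom x (m + n) ≡ geom x m + x ^ m * geom x n
  geom-+ x zero    n = sym (*-identityˡ (geom x n))
  geom-+ x (suc m) n = trans (cong (λ g → 1 + x * g) (geom-+ x m n)) (lem x (geom x m) (x ^ m) (geom x n))
    where
    lem : ∀ x a b c → 1 + x * (a + b * c) ≡ 1 + x * a + x * b * c
    lem = solve-∀

  geom-suc : ∀ x n → geom x (suc n) ≡ x ^ n + geom x n
  geom-suc x n = begin
    geom x (suc n)               ≡⟨ cong (geom x) (+-comm 1 n) ⟩
    geom x (n + 1)               ≡⟨ geom-+ x n 1 ⟩
    geom x n + x ^ n * geom x 1  ≡⟨ lem x (geom x n) (x ^ n) ⟩
    x ^ n + geom x n             ∎
    where
    open ≡-Reasoning
    lem : ∀ x a b → a + b * (1 + x * 0) ≡ b + a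
    lem = solve-∀

  geom-* : ∀ x m n → geom x (n * m) ≡ geom x m * geom (x ^ m) n
  geom-* x m zero    = sym (*-zeroʳ (geom x m))
  geom-* x m (suc n) = begin
    geom x (m + n * m)                             ≡⟨ geom-+ x m (n * m) ⟩
    geom x m + x ^ m * geom x (n * m)              ≡⟨ cong (λ g → geom x m + x ^ m * g) (geom-* x m n) ⟩
    geom x m + x ^ m * (geom x m * geom (x ^ m) n) ≡⟨ lem (geom x m) (x ^ m) (geom (x ^ m) n) ⟩
    geom x m * (1 + x ^ m * geom (x ^ m) n)        ∎
    where
    open ≡-Reasoning
    lem : ∀ a b c → a + b * (a * c) ≡ a * (1 + b * c)
    lem = solve-∀

  ^-geom : ∀ y n → suc y ^ n ≡ 1 + y * geom (suc y) n
  ^-geom y zero    = cong suc (sym (*-zeroʳ y))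
  ^-geom y (suc n) = trans (cong (suc y *_) (^-geom y n)) (lem y (geom (suc y) n))
    where
    lem : ∀ y g → suc y * (1 + y * g) ≡ 1 + y * (1 + suc y * g)
    lem = solve-∀

  -- The second-order expansion of ((1+s)^n − 1)/s, doubled to clear the binomial coefficient.
  geom-expand : ∀ s h → ∃ λ c → 2 * geom (suc s) (suc h) ≡ 2 * suc h + s * (suc h * h) + s * s * c
  geom-expand s zero = 0 , lem s
    where
    lem : ∀ s → 2 * (1 + suc s * 0) ≡ 2 * 1 + s * (1 * 0) + s * s * 0
    lem = solve-∀
  geom-expand s (suc h) with c , eq ← geom-expand s h = suc h * h + c + s * c , (begin
    2 * (1 + suc s * g)   ≡⟨ lem₁ s g ⟩
    2 + suc s * (2 * g)   ≡⟨ cong (λ z → 2 + suc s * z) eq ⟩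
    2 + suc s * (2 * suc h + s * (suc h * h) + s * s * c) ≡⟨ lem₂ s h c ⟩
    2 * suc (suc h) + s * (suc (suc h) * suc h) + s * s * (suc h * h + c + s * c) ∎)
    where
    open ≡-Reasoning
    g = geom (suc s) (suc h)
    lem₁ : ∀ s g → 2 * (1 + suc s * g) ≡ 2 + suc s * (2 * g)
    lem₁ = solve-∀
    lem₂ : ∀ s h c → 2 + suc s * (2 * suc h + s * (suc h * h) + s * s * c)
           ≡ 2 * suc (suc h) + s * (suc (suc h) * suc h) + s * s * (suc h * h + c + s * c)
    lem₂ = solve-∀

  -- Modulo `s` each of the `n` powers of `suc s` is 1.
  geom-≡ : ∀ s n → ∃ λ c → geom (suc s) n ≡ n + s * c
  geom-≡ s zero = 0 , sym (*-zeroʳ s)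
  geom-≡ s (suc n) with c , eq ← geom-≡ s n =
    n + c + s * c , trans (cong (λ g → 1 + suc s * g) eq) (lem s n c)
    where
    lem : ∀ s n c → 1 + suc s * (n + s * c) ≡ suc n + s * (n + c + s * c)
    lem = solve-∀

  -- Every term but the leading 1 is a multiple of `r`. This is why p^k is prime to σ(p^k).
  ∤-geom : ∀ {r} → Prime r → ∀ n → r ∤ geom r (suc n)
  ∤-geom {r} pr n r∣ = prime≢1 pr (∣1⇒≡1 (∣m+n∣m⇒∣n (subst (r ∣_) (+-comm 1 _) r∣) (m∣m*n (geom r n))))

  ∣geom⇒∣ : ∀ {r s} n → r ∣ s → r ∣ geom (suc s) n → r ∣ n
  ∣geom⇒∣ {r} {s} n r∣s r∣g with c , eq ← geom-≡ s n =
    ∣m+n∣m⇒∣n (subst (r ∣_) (trans eq (+-comm n (s * c))) r∣g) (∣m⇒∣m*n c r∣s)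

  -- The core of lifting the exponent: exactly one factor `r` appears. As `r ∣ s`, the doubled
  -- second-order expansion gives 2w ≡ 2 modulo r, so `r ∣ w` would force r = 2.
  geom-r : ∀ {r s} → Prime r → r ≢ 2 → r ∣ s → ∃ λ w → geom (suc s) r ≡ r * w × r ∤ w
  geom-r {zero} pr = contradiction pr ¬prime[0]
  geom-r {r@(suc h)} {s} pr r≢2 r∣s@(divides t refl)
    with c , eq ← geom-≡ s r | d , eq₂ ← geom-expand s h
    = w , geom≡ , r∤w
    where
    w = 1 + t * c
    geom≡ : geom (suc s) r ≡ r * w
    geom≡ = trans eq (lem r t c)
      where
      lem : ∀ r t c → r + t * r * c ≡ r * (1 + t * c)
      lem = solve-∀
    2w≡ : 2 * w ≡ r * (t * h + t * t * d) + 2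
    2w≡ = *-cancelˡ-≡ _ _ r (trans (lem₁ r w) (trans (cong (2 *_) (sym geom≡)) (trans eq₂ (lem₂ r t h d))))
      where
      lem₁ : ∀ r w → r * (2 * w) ≡ 2 * (r * w)
      lem₁ = solve-∀
      lem₂ : ∀ r t h d → 2 * r + t * r * (r * h) + t * r * (t * r) * d ≡ r * (r * (t * h + t * t * d) + 2)
      lem₂ = solve-∀
    r∤w : r ∤ w
    r∤w r∣w = r≢2 (prime∣prime⇒≡ pr prime[2]
      (∣m+n∣m⇒∣n (subst (r ∣_) 2w≡ (∣n⇒∣m*n 2 r∣w)) (m∣m*n (t * h + t * t * d))))

  -- The part of lifting the exponent that is needed: v_r((x^n − 1)/(x − 1)) ≤ v_r(n).
  lte : ∀ {r} → Prime r → r ≢ 2 → ∀ e n s → r ∣ s → r ^ e ∣ geom (suc s) n → r ^ e ∣ n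
  lte pr r≢2 zero n s _ _ = 1∣ n
  lte {r} pr r≢2 (suc e) n s r∣s re∣
    with divides n′ refl ← ∣geom⇒∣ n r∣s (∣-trans (m∣m*n (r ^ e)) re∣)
    with w , eq , r∤w ← geom-r pr r≢2 r∣s
    = subst (r ^ suc e ∣_) (*-comm r n′) (*-monoʳ-∣ r (lte pr r≢2 e n′ s′ r∣s′ (coprime-divisor (prime^∤⇒coprime e pr r∤w) re∣′)))
    where
    instance _ = prime⇒nonZero pr
    -- `suc s′` is `suc s ^ r`, the base for the recursive call with exponent `n′`; the other factor
    -- `geom (suc s) r` absorbs exactly one `r`.
    s′ = s * geom (suc s) r
    r∣s′ : r ∣ s′
    r∣s′ = ∣m⇒∣m*n _ r∣s
    re∣′ : r ^ e ∣ w * geom (suc s′) n′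
    re∣′ = *-cancelˡ-∣ r (subst (r ^ suc e ∣_) (begin
      geom (suc s) (n′ * r)               ≡⟨ geom-* (suc s) r n′ ⟩
      geom (suc s) r * geom (suc s ^ r) n′ ≡⟨ cong₂ (λ a b → a * geom b n′) eq (^-geom s r) ⟩
      r * w * geom (suc s′) n′            ≡⟨ *-assoc r w _ ⟩
      r * (w * geom (suc s′) n′)          ∎) re∣)
      where open ≡-Reasoning

  -- Divisor sums

  ∈-divisors⁺ : ∀ {d n} → .{{NonZero n}} → d ∣ n → d ∈ divisors n
  ∈-divisors⁺ {zero}  {n} d∣n = contradiction (0∣⇒≡0 d∣n) (≢-nonZero⁻¹ n)
  ∈-divisors⁺ {suc d} {n} d∣n = ∈-filter⁺ (_∣? n) (∈-map⁺ suc (∈-upTo⁺ (∣⇒≤ d∣n))) d∣n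

  ∈-divisors⁻ : ∀ {d n} → d ∈ divisors n → d ∣ n
  ∈-divisors⁻ {n = n} = proj₂ ∘ ∈-filter⁻ (_∣? n) {xs = map suc (upTo n)}

  divisors-unique : ∀ n → Unique (divisors n)
  divisors-unique n = Unique.filter⁺ (_∣? n) (Unique.map⁺ suc-injective (Unique.upTo⁺ n))

  sum-map-* : ∀ r xs → sum (map (r *_) xs) ≡ r * sum xs
  sum-map-* r []       = sym (*-zeroʳ r)
  sum-map-* r (x ∷ xs) = trans (cong (r * x +_) (sum-map-* r xs)) (sym (*-distribˡ-+ r x (sum xs)))

  -- A divisor of r^(j+1) B is either prime to r, hence divides B, or r times a divisor of r^j B.
  σ-step : ∀ {r B} → Prime r → r ∤ B → ∀ j → σ (r ^ suc j * B) ≡ σ B + r * σ (r ^ j * B)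
  σ-step {r} {B} pr r∤B j = begin
    sum (divisors C)                            ≡⟨ sum-↭ (∼bag⇒↭ (unique∧set⇒bag (divisors-unique C) unique-rhs (mk⇔ to from))) ⟩
    sum (divisors B ++ map (r *_) (divisors D)) ≡⟨ sum-++ (divisors B) _ ⟩
    σ B + sum (map (r *_) (divisors D))         ≡⟨ cong (σ B +_) (sum-map-* r (divisors D)) ⟩
    σ B + r * σ D                               ∎
    where
    open ≡-Reasoning
    C = r ^ suc j * B
    D = r ^ j * B
    C≡rD : C ≡ r * D
    C≡rD = *-assoc r (r ^ j) B
    instance
      r≢0 : NonZero r
      r≢0 = prime⇒nonZero pr
      B≢0 : NonZero B
      B≢0 = ≢-nonZero λ { refl → r∤B (r ∣0) }
      D≢0 : NonZero D
      D≢0 = m*n≢0 (r ^ j) B {{m^n≢0 r j}}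
      C≢0 : NonZero C
      C≢0 = m*n≢0 (r ^ suc j) B {{m^n≢0 r (suc j)}}
    unique-rhs : Unique (divisors B ++ map (r *_) (divisors D))
    unique-rhs = Unique.++⁺ (divisors-unique B) (Unique.map⁺ (*-cancelˡ-≡ _ _ r) (divisors-unique D)) disjoint
      where
      disjoint : ∀ {d} → ¬ (d ∈ divisors B × d ∈ map (r *_) (divisors D))
      disjoint (d∈B , d∈rD) with e , _ , refl ← ∈-map⁻ (r *_) d∈rD = r∤B (∣-trans (m∣m*n e) (∈-divisors⁻ d∈B))
    to : ∀ {d} → d ∈ divisors C → d ∈ divisors B ++ map (r *_) (divisors D)
    to {d} d∈ with r ∣? d
    ... | no r∤d = ∈-++⁺ˡ (∈-divisors⁺ (coprime-divisor (Coprimality.sym (prime^∤⇒coprime (suc j) pr r∤d)) (∈-divisors⁻ d∈)))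
    ... | yes (divides e refl) = ∈-++⁺ʳ (divisors B) (subst (_∈ map (r *_) (divisors D)) (*-comm r e)
            (∈-map⁺ (r *_) (∈-divisors⁺ (*-cancelˡ-∣ r (subst (_∣ r * D) (*-comm e r) (subst (e * r ∣_) C≡rD (∈-divisors⁻ d∈)))))))
    from : ∀ {d} → d ∈ divisors B ++ map (r *_) (divisors D) → d ∈ divisors C
    from d∈ with ∈-++⁻ (divisors B) d∈
    ... | inj₁ d∈B = ∈-divisors⁺ (∣n⇒∣m*n (r ^ suc j) (∈-divisors⁻ d∈B))
    ... | inj₂ d∈rD with e , e∈D , refl ← ∈-map⁻ (r *_) d∈rD =
      ∈-divisors⁺ (subst (r * e ∣_) (sym C≡rD) (*-monoʳ-∣ r (∈-divisors⁻ e∈D)))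

  -- Unrolling `σ-step` is Horner's scheme for `geom`. This is the one case of multiplicativity of σ
  -- that the argument calls on.
  σ-prime^-* : ∀ {r B} → Prime r → r ∤ B → ∀ j → σ (r ^ j * B) ≡ geom r (suc j) * σ B
  σ-prime^-* {r} {B} pr r∤B zero = trans (cong σ (*-identityˡ B)) (lem r (σ B))
    where
    lem : ∀ r x → x ≡ (1 + r * 0) * x
    lem = solve-∀
  σ-prime^-* {r} {B} pr r∤B (suc j) = begin
    σ (r ^ suc j * B)                ≡⟨ σ-step pr r∤B j ⟩
    σ B + r * σ (r ^ j * B)          ≡⟨ cong (λ z → σ B + r * z) (σ-prime^-* pr r∤B j) ⟩
    σ B + r * (geom r (suc j) * σ B) ≡⟨ lem r (geom r (suc j)) (σ B) ⟩
    (1 + r * geom r (suc j)) * σ B   ∎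
    where
    open ≡-Reasoning
    lem : ∀ r g x → x + r * (g * x) ≡ (1 + r * g) * x
    lem = solve-∀

  σ-prime^ : ∀ {r} → Prime r → ∀ j → σ (r ^ j) ≡ geom r (suc j)
  σ-prime^ {r} pr j = begin
    σ (r ^ j)            ≡⟨ cong σ (sym (*-identityʳ (r ^ j))) ⟩
    σ (r ^ j * 1)        ≡⟨ σ-prime^-* pr (prime≢1 pr ∘ ∣1⇒≡1) j ⟩
    geom r (suc j) * 1   ≡⟨ *-identityʳ _ ⟩
    geom r (suc j)       ∎
    where open ≡-Reasoning

  -- The case σ(m²) = p^k

  odd⇒2∤ : ∀ {n} → n % 2 ≡ 1 → 2 ∤ n
  odd⇒2∤ {n} n%2≡1 2∣n with () ← trans (sym n%2≡1) (n∣m⇒m%n≡0 n 2 2∣n)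

  -- Since σ(r^(2a)) is a power x of p with r ∥ x − 1, divisibility of σ(p^k) by r^(2a) forces
  -- r^(2a−1) ∣ k+1 by lifting the exponent.
  primePower∣1+k : ∀ {p r} k a m′ → Prime p → Prime r → r ≢ 2 → r ∤ m′ →
    let m = r ^ suc a * m′ in
    σ (m * m) ≡ p ^ k → m * m ∣ geom p (suc k) → r ^ suc a ∣ suc k
  primePower∣1+k {zero} _ _ _ pp = contradiction pp ¬prime[0]
  primePower∣1+k {p@(suc p′)} {r} k a m′ pp pr r≢2 r∤m′ σ≡ mm∣
    = ∣-trans (subst (r ^ suc a ∣_) (sym (^-distribˡ-+-* r a (suc a))) (n∣m*n (r ^ a)))
        (lte pr r≢2 f (suc k) s (m∣m*n _) (coprime-divisor (prime^∤⇒coprime f pr (∤-geom pr f)) rf∣))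
    where
    instance _ = prime⇒nonZero pr
    m = r ^ suc a * m′
    e = suc a + suc a
    σmm≡ : σ (m * m) ≡ geom r (suc e) * σ (m′ * m′)
    σmm≡ = trans (cong σ (trans (lem (r ^ suc a) m′) (cong (_* (m′ * m′)) (sym (^-distribˡ-+-* r (suc a) (suc a))))))
                 (σ-prime^-* pr (λ d → [ r∤m′ , r∤m′ ] (euclidsLemma m′ m′ pr d)) e)
      where
      lem : ∀ x y → x * y * (x * y) ≡ x * x * (y * y)
      lem = solve-∀
    -- `e` reduces to `suc f`, so `suc s` is `geom r (suc e)`, the value σ(r^e). One factor `r` of
    -- r^e is spent on `s`, which leaves r^f.
    f = a + suc a
    s = r * geom r (suc f)
    power : ∃ λ b → suc s ≡ p ^ b
    power = ∣p^⇒≡p^ pp k (divides (σ (m′ * m′)) (trans (sym σ≡) (trans σmm≡ (*-comm _ (σ (m′ * m′))))))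
    b = proj₁ power
    p^b≡ : p ^ b ≡ suc s
    p^b≡ = sym (proj₂ power)
    p′g≡s : p′ * geom p b ≡ s
    p′g≡s = suc-injective (trans (sym (^-geom p′ b)) p^b≡)
    re∣ : r ^ suc f ∣ geom p (suc k)
    re∣ = ∣-trans (divides (m′ * m′) (trans (lem (r ^ suc a) m′) (cong ((m′ * m′) *_) (sym (^-distribˡ-+-* r (suc a) (suc a)))))) mm∣
      where
      lem : ∀ x y → x * y * (x * y) ≡ y * y * (x * x)
      lem = solve-∀
    -- Here p^(b(k+1)) - 1 is computed in two ways, using p^b = 1 + s: as p - 1 times a geometric
    -- sum in p, and as s times one in 1 + s.
    chain : p′ * geom p (b * suc k) ≡ r * (geom r (suc f) * geom (suc s) (suc k))
    chain = begin
      p′ * geom p (b * suc k)                    ≡⟨ cong (λ z → p′ * geom p z) (*-comm b (suc k)) ⟩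
      p′ * geom p (suc k * b)                    ≡⟨ cong (p′ *_) (geom-* p b (suc k)) ⟩
      p′ * (geom p b * geom (p ^ b) (suc k))     ≡⟨ sym (*-assoc p′ _ _) ⟩
      p′ * geom p b * geom (p ^ b) (suc k)       ≡⟨ cong₂ (λ y z → y * geom z (suc k)) p′g≡s p^b≡ ⟩
      s * geom (suc s) (suc k)                   ≡⟨ *-assoc r _ _ ⟩
      r * (geom r (suc f) * geom (suc s) (suc k)) ∎
      where open ≡-Reasoning
    -- `geom p (suc k)` divides `geom p (b * suc k)`, so r^(f+1) divides both sides of `chain`.
    rf∣ : r ^ f ∣ geom r (suc f) * geom (suc s) (suc k)
    rf∣ = *-cancelˡ-∣ r (subst (r ^ suc f ∣_) chain (∣n⇒∣m*n p′ (subst (r ^ suc f ∣_) (sym (geom-* p (suc k) b)) (∣m⇒∣m*n _ re∣))))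

  -- A power of `r` dividing `m` divides the full `r`-part of `m`, and oddness of `m` makes `r` odd,
  -- as lifting the exponent requires.
  m∣1+k : ∀ {p} k m → .{{NonZero m}} → Prime p → 2 ∤ m →
    σ (m * m) ≡ p ^ k → m * m ∣ geom p (suc k) → m ∣ suc k
  m∣1+k k m pp 2∤m σ≡ mm∣ = primePowers⇒∣ (suc k) m helper
    where
    helper : ∀ r e → Prime r → r ^ e ∣ m → r ^ e ∣ suc k
    helper r e pr re∣m with extract pr m
    ... | a , m′ , eq , r∤m′ with coprime-divisor (prime^∤⇒coprime e pr r∤m′)
                                    (subst (r ^ e ∣_) (trans eq (*-comm (r ^ a) m′)) re∣m)
    helper r e pr re∣m | zero , m′ , eq , r∤m′ | re∣1 = ∣-trans re∣1 (1∣ suc k)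
    helper r e pr re∣m | suc a , m′ , refl , r∤m′ | re∣ra =
      ∣-trans re∣ra (primePower∣1+k k a m′ pp pr r≢2 r∤m′ σ≡ mm∣)
      where
      r≢2 : r ≢ 2
      r≢2 refl = 2∤m (∣m⇒∣m*n m′ (m∣m*n (r ^ a)))

  -- Written for k = 3 + j, so that `4 + j` is k + 1. The polynomial added in the induction step is
  -- the surplus 10(4 + j)² - 2(5 + j)².
  2[4+j]²≤5^[3+j] : ∀ j → 2 * ((4 + j) * (4 + j)) ≤ 5 ^ (3 + j)
  2[4+j]²≤5^[3+j] zero = m≤m+n 32 93
  2[4+j]²≤5^[3+j] (suc j) = begin
    2 * ((5 + j) * (5 + j))                               ≤⟨ m≤m+n _ (110 + 60 * j + 8 * (j * j)) ⟩
    2 * ((5 + j) * (5 + j)) + (110 + 60 * j + 8 * (j * j)) ≡⟨ lem j ⟩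
    5 * (2 * ((4 + j) * (4 + j)))                         ≤⟨ *-monoʳ-≤ 5 (2[4+j]²≤5^[3+j] j) ⟩
    5 * 5 ^ (3 + j)                                       ∎
    where
    open ≤-Reasoning
    lem : ∀ j → 2 * ((5 + j) * (5 + j)) + (110 + 60 * j + 8 * (j * j)) ≡ 5 * (2 * ((4 + j) * (4 + j)))
    lem = solve-∀

  σ[m²]≢p^k : ∀ {p} k m → .{{NonZero m}} → Prime p → 5 ≤ p → k % 4 ≡ 1 → 2 ∤ m →
    geom p (suc k) ≡ 2 * (m * m) → σ (m * m) ≢ p ^ k
  σ[m²]≢p^k {p} k m pp 5≤p k%4≡1 2∤m S≡ σ≡ = by-size k k%4≡1 m≤1+k size
    where
    instance _ = prime⇒nonZero pp
    m≤1+k : m ≤ suc k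
    m≤1+k = ∣⇒≤ (m∣1+k k m pp 2∤m σ≡ (subst (m * m ∣_) (sym S≡) (n∣m*n 2)))
    size : p ^ k + geom p k ≤ 2 * (m * m)
    size = ≤-reflexive (trans (sym (geom-suc p k)) S≡)
    -- The congruence excludes k = 0 and k = 2. At k = 1, m ≤ 2 and oddness give m ≤ 1, too small
    -- for 5 ≤ p. From k = 3 on, p^k is at least 2(k + 1)².
    by-size : ∀ k → k % 4 ≡ 1 → m ≤ suc k → p ^ k + geom p k ≤ 2 * (m * m) → ⊥
    by-size 0 ()
    by-size 1 _ m≤2 le = <⇒≱ 2m²<5 (≤-trans 5≤p (≤-trans (≤-reflexive (sym (^-identityʳ p))) (m+n≤o⇒m≤o (p ^ 1) le)))
      where
      m≤1 : m ≤ 1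
      m≤1 = s≤s⁻¹ (≤∧≢⇒< m≤2 λ { refl → 2∤m ∣-refl })
      2m²<5 : 2 * (m * m) < 5
      2m²<5 = ≤-trans (s≤s (*-monoʳ-≤ 2 (*-mono-≤ m≤1 m≤1))) (m≤m+n 3 2)
    by-size 2 ()
    by-size (suc (suc (suc j))) _ m≤4+j le = <⇒≱ p^k<2m² (begin
      2 * (m * m)               ≤⟨ *-monoʳ-≤ 2 (*-mono-≤ m≤4+j m≤4+j) ⟩
      2 * ((4 + j) * (4 + j))   ≤⟨ 2[4+j]²≤5^[3+j] j ⟩
      5 ^ (3 + j)               ≤⟨ ^-monoˡ-≤ (3 + j) 5≤p ⟩
      p ^ (3 + j)               ∎)
      where
      open ≤-Reasoning
      p^k<2m² : p ^ (3 + j) < 2 * (m * m)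
      p^k<2m² = ≤-trans (≤-trans (≤-reflexive (+-comm 1 _)) (+-monoʳ-≤ (p ^ (3 + j)) (s≤s z≤n))) le

  -- Structure of an odd perfect number

  prime≡1[4]⇒≥5 : ∀ {p} → Prime p → p % 4 ≡ 1 → 5 ≤ p
  prime≡1[4]⇒≥5 {0} _ ()
  prime≡1[4]⇒≥5 {1} pp _ = contradiction pp ¬prime[1]
  prime≡1[4]⇒≥5 {2} _ ()
  prime≡1[4]⇒≥5 {3} _ ()
  prime≡1[4]⇒≥5 {4} _ ()
  prime≡1[4]⇒≥5 {suc (suc (suc (suc (suc p))))} _ _ = m≤m+n 5 p

  ≡1[4]⇒2∣suc : ∀ n → n % 4 ≡ 1 → 2 ∣ suc n
  ≡1[4]⇒2∣suc n n%4≡1 = divides (1 + 2 * (n / 4)) (trans (cong suc (m≡m%n+[m/n]*n n 4))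
    (trans (cong (λ z → suc (z + n / 4 * 4)) n%4≡1) (lem (n / 4))))
    where
    lem : ∀ q → suc (1 + q * 4) ≡ (1 + 2 * q) * 2
    lem = solve-∀

  -- The left side is at most (p - 1) · `geom p k` = p^k - 1. As σ(p^k) = p^k + `geom p k`, this is
  -- the source of σ(p^k)/p^k < 5/4.
  4*geom<^ : ∀ {p} → 5 ≤ p → ∀ k → 4 * geom p k < p ^ k
  4*geom<^ {suc p′} (s≤s 4≤p′) k = begin-strict
    4 * geom (suc p′) k      ≤⟨ *-monoˡ-≤ (geom (suc p′) k) 4≤p′ ⟩
    p′ * geom (suc p′) k     <⟨ n<1+n _ ⟩
    1 + p′ * geom (suc p′) k ≡⟨ sym (^-geom p′ k) ⟩
    suc p′ ^ k               ∎
    where open ≤-Reasoning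

  -- The sum is k + 1 modulo p - 1, and both k + 1 and p - 1 are even.
  2∣geom : ∀ {p} k → p % 4 ≡ 1 → k % 4 ≡ 1 → 2 ∣ geom p (suc k)
  2∣geom {zero} k ()
  2∣geom {suc p′} k p%4 k%4 with c , eq ← geom-≡ p′ (suc k) =
    subst (2 ∣_) (sym eq) (∣m∣n⇒∣m+n (≡1[4]⇒2∣suc k k%4) (∣m⇒∣m*n c (∣m+n∣m⇒∣n (≡1[4]⇒2∣suc (suc p′) p%4) ∣-refl)))

  -- The quotient s = σ(m²) / p^k is written 3 + d, and g = σ(p^k) − p^k.
  record Structure (q S M T : ℕ) : Set where
    constructor structure
    field
      g d : ℕ
      S≡  : S ≡ q + g
      1≤g : 1 ≤ g
      4g<q : 4 * g < q
      T≡   : T ≡ (3 + d) * q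
      2M≡  : 2 * M ≡ S * (3 + d)

  oddPerfect-structure : ∀ p k m → Prime p → 1 ≤ k → .{{NonZero m}} →
    p % 4 ≡ 1 → k % 4 ≡ 1 → gcd p m ≡ 1 → (p ^ k * (m * m)) % 2 ≡ 1 →
    σ (p ^ k * (m * m)) ≡ 2 * (p ^ k * (m * m)) →
    Structure (p ^ k) (σ (p ^ k)) (m * m) (σ (m * m))
  oddPerfect-structure p k@(suc _) m pp _ p%4 k%4 gcd≡1 odd perfect = result T∣
    where
    q = p ^ k
    M = m * m
    S = geom p (suc k)
    T = σ M
    instance
      _ = prime⇒nonZero pp
      q≢0 : NonZero q
      q≢0 = m^n≢0 p k
      M≢0 : NonZero M
      M≢0 = m*n≢0 m m
    5≤p : 5 ≤ p
    5≤p = prime≡1[4]⇒≥5 pp p%4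
    p∤m : p ∤ m
    p∤m p∣m = prime≢1 pp (Coprimality.gcd≡1⇒coprime gcd≡1 (∣-refl , p∣m))
    p∤M : p ∤ M
    p∤M d = [ p∤m , p∤m ] (euclidsLemma m m pp d)
    2∤M : 2 ∤ M
    2∤M 2∣M = odd⇒2∤ odd (∣n⇒∣m*n q 2∣M)
    2∤m : 2 ∤ m
    2∤m 2∣m = 2∤M (∣m⇒∣m*n m 2∣m)
    ST≡ : S * T ≡ 2 * (q * M)
    ST≡ = trans (sym (σ-prime^-* pp p∤M k)) perfect
    T∣ : q ∣ T
    T∣ = coprime-divisor (prime^∤⇒coprime k pp (∤-geom pp k)) (subst (q ∣_) (sym ST≡) (∣n⇒∣m*n 2 (m∣m*n M)))
    result : q ∣ T → Structure q (σ q) M T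
    result (divides s T≡) = go s T≡ (*-cancelˡ-≡ _ _ q (trans (lem₁ q M) (trans (sym ST≡) (trans (cong (S *_) T≡) (lem₂ S s q)))))
      where
      lem₁ : ∀ q M → q * (2 * M) ≡ 2 * (q * M)
      lem₁ = solve-∀
      lem₂ : ∀ S s q → S * (s * q) ≡ q * (S * s)
      lem₂ = solve-∀
      go : ∀ s → T ≡ s * q → 2 * M ≡ S * s → Structure q (σ q) M T
      -- The value 0 would give 2M = 0, the value 1 would give σ(m²) = p^k, and the value 2 would
      -- make M equal to the even number S.
      go 0 _ eq = contradiction (trans eq (*-zeroʳ S)) (≢-nonZero⁻¹ (2 * M) {{m*n≢0 2 M}})
      go 1 T≡ eq = contradiction (trans T≡ (*-identityˡ q))
        (σ[m²]≢p^k k m pp 5≤p k%4 2∤m (trans (sym (*-identityʳ S)) (sym eq)))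
      go 2 T≡ eq = contradiction (subst (2 ∣_) (sym (*-cancelˡ-≡ M S 2 (trans eq (*-comm S 2)))) (2∣geom {p} k p%4 k%4)) 2∤M
      -- Here g = 1 + p + ... + p^(k-1), which is at least 1 because `k` is a successor.
      go (suc (suc (suc d))) T≡ eq = structure (geom p k) d (trans (σ-prime^ pp k) (geom-suc p k)) (s≤s z≤n)
        (4*geom<^ 5≤p k) T≡ (trans eq (cong (_* (3 + d)) (sym (σ-prime^ pp k))))

  -- Ratio bounds, with denominators cleared

  module Bounds {q S M T : ℕ} (str : Structure q S M T) where
    open Structure str
    open ≤-Reasoning

    -- With x = S/q and s = `scale`, the relations T = s q and 2M = S s give T/M = 2/x, S/M = 2/s
    -- and T/q = s. Each bound below is one on x or on s.
    scale : ℕ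
    scale = 3 + d

    q<S : q < S
    q<S rewrite S≡ = ≤-trans (≤-reflexive (+-comm 1 q)) (+-monoʳ-≤ q 1≤g)

    4S<5q : 4 * S < 5 * q
    4S<5q rewrite S≡ = begin-strict
      4 * (q + g)      ≡⟨ *-distribˡ-+ 4 q g ⟩
      4 * q + 4 * g    <⟨ +-monoʳ-< (4 * q) 4g<q ⟩
      4 * q + q        ≡⟨ +-comm (4 * q) q ⟩
      5 * q            ∎

    3S≤2M : 3 * S ≤ 2 * M
    3S≤2M = begin
      3 * S        ≡⟨ *-comm 3 S ⟩
      S * 3        ≤⟨ *-monoʳ-≤ S (m≤m+n 3 d) ⟩
      S * (3 + d)  ≡⟨ sym 2M≡ ⟩
      2 * M        ∎

    3q≤T : 3 * q ≤ T
    3q≤T rewrite T≡ = *-monoˡ-≤ q (m≤m+n 3 d)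

    -- As T/M = 2/x, the bound x < 5/4 inverts to T/M > 8/5.
    8M<5T : 8 * M < 5 * T
    8M<5T rewrite T≡ = begin-strict
      8 * M               ≡⟨ *-assoc 4 2 M ⟩
      4 * (2 * M)         ≡⟨ cong (4 *_) 2M≡ ⟩
      4 * (S * scale)     ≡⟨ sym (*-assoc 4 S scale) ⟩
      4 * S * scale       <⟨ *-monoˡ-< scale 4S<5q ⟩
      5 * q * scale       ≡⟨ *-assoc 5 q scale ⟩
      5 * (q * scale)     ≡⟨ cong (5 *_) (*-comm q scale) ⟩
      5 * (scale * q)     ∎

    T<2M : T < 2 * M
    T<2M rewrite T≡ = begin-strict
      scale * q  ≡⟨ *-comm scale q ⟩
      q * scale  <⟨ *-monoˡ-< scale q<S ⟩
      S * scale  ≡⟨ sym 2M≡ ⟩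
      2 * M      ∎

    -- With x = S / q we have S / q + T / M = x + 2/x, and
    -- 20 (x + 2/x) − 57 is a positive multiple of (x − 5/4)(x − 8/5).
    57qM<20[SM+Tq] : 57 * (q * M) < 20 * (S * M + T * q)
    -- Doubling lets `2 * M` be replaced by `S * scale`; then `scale` factors out and an inequality
    -- between quadratics in q and S remains.
    57qM<20[SM+Tq] rewrite T≡ = *-cancelˡ-< 2 _ _ (begin-strict
      2 * (57 * (q * M))                            ≡⟨ lem₁ q M ⟩
      57 * q * (2 * M)                              ≡⟨ cong (57 * q *_) 2M≡ ⟩
      57 * q * (S * scale)                          ≡⟨ lem₂ q S scale ⟩
      57 * (q * S) * scale                          <⟨ *-monoˡ-< scale quadratic ⟩
      (20 * (S * S) + 40 * (q * q)) * scale         ≡⟨ lem₃ S q scale ⟩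
      20 * (S * (S * scale)) + 40 * (scale * q * q) ≡⟨ cong (λ z → 20 * (S * z) + 40 * (scale * q * q)) (sym 2M≡) ⟩
      20 * (S * (2 * M)) + 40 * (scale * q * q)     ≡⟨ lem₄ S M (scale * q * q) ⟩
      2 * (20 * (S * M + scale * q * q))            ∎)
      where
      lem₁ : ∀ q M → 2 * (57 * (q * M)) ≡ 57 * q * (2 * M)
      lem₁ = solve-∀
      lem₂ : ∀ q S c → 57 * q * (S * c) ≡ 57 * (q * S) * c
      lem₂ = solve-∀
      lem₃ : ∀ S q c → (20 * (S * S) + 40 * (q * q)) * c ≡ 20 * (S * (S * c)) + 40 * (c * q * q)
      lem₃ = solve-∀
      lem₄ : ∀ S M z → 20 * (S * (2 * M)) + 40 * z ≡ 2 * (20 * (S * M + z))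
      lem₄ = solve-∀
      -- `h` is the slack in 4g < q. With S = q + g the sides of `quadratic` differ by (q - 4g)(3q -
      -- 5g), which at q = 4g + 1 + h is (1 + h)(3 + 7g + 3h), free of negative terms.
      h = q ∸ suc (4 * g)
      lem₅ : ∀ g h → let q = suc (4 * g) + h in
        20 * ((q + g) * (q + g)) + 40 * (q * q) ≡ suc (57 * (q * (q + g)) + (2 + 3 * h * h + 7 * g + 7 * g * h + 6 * h))
      lem₅ = solve-∀
      quadratic : 57 * (q * S) < 20 * (S * S) + 40 * (q * q)
      quadratic rewrite S≡ | sym (m+[n∸m]≡n 4g<q) =
        ≤-trans (s≤s (m≤m+n _ _)) (≤-reflexive (sym (lem₅ g h)))

    -- The bound x + 2/x < 3 amounts to (x - 1)(x - 2) < 0. With S = q + g the gap 3qS - S² - 2q² is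
    -- g(q - g), positive as 1 ≤ g < q.
    SM+Tq<3qM : S * M + T * q < 3 * (q * M)
    SM+Tq<3qM rewrite T≡ = *-cancelˡ-< 2 _ _ (begin-strict
      2 * (S * M + scale * q * q)             ≡⟨ lem₁ S M (scale * q * q) ⟩
      S * (2 * M) + 2 * (scale * q * q)       ≡⟨ cong (λ z → S * z + 2 * (scale * q * q)) 2M≡ ⟩
      S * (S * scale) + 2 * (scale * q * q)   ≡⟨ lem₂ S q scale ⟩
      (S * S + 2 * (q * q)) * scale           <⟨ *-monoˡ-< scale quadratic ⟩
      3 * (q * S) * scale                     ≡⟨ lem₃ q S scale ⟩
      3 * q * (S * scale)                     ≡⟨ cong (3 * q *_) (sym 2M≡) ⟩
      3 * q * (2 * M)                         ≡⟨ lem₄ q M ⟩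
      2 * (3 * (q * M))                       ∎)
      where
      lem₁ : ∀ S M z → 2 * (S * M + z) ≡ S * (2 * M) + 2 * z
      lem₁ = solve-∀
      lem₂ : ∀ S q c → S * (S * c) + 2 * (c * q * q) ≡ (S * S + 2 * (q * q)) * c
      lem₂ = solve-∀
      lem₃ : ∀ q S c → 3 * (q * S) * c ≡ 3 * q * (S * c)
      lem₃ = solve-∀
      lem₄ : ∀ q M → 3 * q * (2 * M) ≡ 2 * (3 * (q * M))
      lem₄ = solve-∀
      lem₅ : ∀ q g → (q + g) * (q + g) + 2 * (q * q) ≡ 3 * (q * q) + 2 * (q * g) + g * g
      lem₅ = solve-∀
      lem₆ : ∀ q g → 3 * (q * q) + 2 * (q * g) + q * g ≡ 3 * (q * (q + g))
      lem₆ = solve-∀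
      g<q : g < q
      g<q = ≤-<-trans (m≤n*m g 4) 4g<q
      quadratic : S * S + 2 * (q * q) < 3 * (q * S)
      quadratic rewrite S≡ = begin-strict
        (q + g) * (q + g) + 2 * (q * q)     ≡⟨ lem₅ q g ⟩
        3 * (q * q) + 2 * (q * g) + g * g   <⟨ +-monoʳ-< _ (*-monoˡ-< g {{>-nonZero 1≤g}} g<q) ⟩
        3 * (q * q) + 2 * (q * g) + q * g   ≡⟨ lem₆ q g ⟩
        3 * (q * (q + g))                   ∎

    -- This is s + 2/s ≥ 11/3 for s ≥ 3, which follows from 3s² - 11s + 6 = (s - 3)(3s - 2).
    11Mq≤3[Sq+TM] : 11 * (M * q) ≤ 3 * (S * q + T * M)
    11Mq≤3[Sq+TM] rewrite T≡ = *-cancelˡ-≤ 2 (begin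
      2 * (11 * (M * q))                          ≡⟨ lem₁ M q ⟩
      11 * (2 * M) * q                            ≡⟨ cong (λ z → 11 * z * q) 2M≡ ⟩
      -- The added term is S q times (s - 3)(3s - 2) at s = 3 + d.
      11 * (S * scale) * q                        ≤⟨ m≤m+n _ (S * q * (7 * d + 3 * (d * d))) ⟩
      11 * (S * scale) * q + S * q * (7 * d + 3 * (d * d)) ≡⟨ lem₂ S q d ⟩
      6 * (S * q) + 3 * (scale * q * (S * scale)) ≡⟨ cong (λ z → 6 * (S * q) + 3 * (scale * q * z)) (sym 2M≡) ⟩
      6 * (S * q) + 3 * (scale * q * (2 * M))     ≡⟨ lem₃ S q scale M ⟩
      2 * (3 * (S * q + scale * q * M))           ∎)
      where
      lem₁ : ∀ M q → 2 * (11 * (M * q)) ≡ 11 * (2 * M) * q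
      lem₁ = solve-∀
      lem₂ : ∀ S q d → 11 * (S * (3 + d)) * q + S * q * (7 * d + 3 * (d * d)) ≡ 6 * (S * q) + 3 * ((3 + d) * q * (S * (3 + d)))
      lem₂ = solve-∀
      lem₃ : ∀ S q c M → 6 * (S * q) + 3 * (c * q * (2 * M)) ≡ 2 * (3 * (S * q + c * q * M))
      lem₃ = solve-∀

-- Order and addition of fractions by cross-multiplication

module Ratio where

  import Data.Nat as ℕ
  import Data.Nat.Properties as ℕ
  open import Data.Integer as ℤ using (+_)
  import Data.Integer.Properties as ℤ
  open import Data.Rational using (_<_; _≤_; _+_; toℚᵘ)
  open import Data.Rational.Properties using (toℚᵘ-cancel-<; toℚᵘ-cancel-≤; toℚᵘ-homo-+; toℚᵘ-fromℚᵘ; toℚᵘ-injective)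
  open import Data.Rational.Unnormalised as ℚᵘ using (mkℚᵘ; *≤*; *<*)
  import Data.Rational.Unnormalised.Properties as ℚᵘ
  open import Relation.Binary.PropositionalEquality using (sym; cong; cong₂; subst₂)

  -- `÷` normalises its result, so the comparison is moved to unnormalised rationals, whose order is
  -- cross-multiplication by definition.
  ÷-mono-< : ∀ a b c d → .{{ℕ.NonZero b}} → .{{ℕ.NonZero d}} → a * d ℕ.< c * b → a ÷ b < c ÷ d
  ÷-mono-< a b@(ℕ.suc b′) c d@(ℕ.suc d′) lt = toℚᵘ-cancel-<
    (ℚᵘ.<-respˡ-≃ (ℚᵘ.≃-sym (toℚᵘ-fromℚᵘ (mkℚᵘ (+ a) b′)))
    (ℚᵘ.<-respʳ-≃ (ℚᵘ.≃-sym (toℚᵘ-fromℚᵘ (mkℚᵘ (+ c) d′)))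
    (*<* (subst₂ ℤ._<_ (ℤ.pos-* a d) (ℤ.pos-* c b) (ℤ.+<+ lt)))))

  ÷-mono-≤ : ∀ a b c d → .{{ℕ.NonZero b}} → .{{ℕ.NonZero d}} → a * d ℕ.≤ c * b → a ÷ b ≤ c ÷ d
  ÷-mono-≤ a b@(ℕ.suc b′) c d@(ℕ.suc d′) le = toℚᵘ-cancel-≤
    (ℚᵘ.≤-respˡ-≃ (ℚᵘ.≃-sym (toℚᵘ-fromℚᵘ (mkℚᵘ (+ a) b′)))
    (ℚᵘ.≤-respʳ-≃ (ℚᵘ.≃-sym (toℚᵘ-fromℚᵘ (mkℚᵘ (+ c) d′)))
    (*≤* (subst₂ ℤ._≤_ (ℤ.pos-* a d) (ℤ.pos-* c b) (ℤ.+≤+ le)))))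

  -- The unnormalised sum already has denominator b d; what remains is to move the numerator's
  -- products from ℤ to ℕ and to pass normalisation.
  ÷-+ : ∀ a b c d → .{{ℕ.NonZero b}} → .{{ℕ.NonZero d}} → a ÷ b + c ÷ d ≡ (a * d ℕ.+ c * b) ÷ (b * d)
  ÷-+ a b@(ℕ.suc b′) c d@(ℕ.suc d′) = toℚᵘ-injective (begin
    toℚᵘ (a ÷ b + c ÷ d)               ≈⟨ toℚᵘ-homo-+ (a ÷ b) (c ÷ d) ⟩
    toℚᵘ (a ÷ b) ℚᵘ.+ toℚᵘ (c ÷ d)     ≈⟨ ℚᵘ.+-cong (toℚᵘ-fromℚᵘ (mkℚᵘ (+ a) b′)) (toℚᵘ-fromℚᵘ (mkℚᵘ (+ c) d′)) ⟩
    mkℚᵘ (+ a) b′ ℚᵘ.+ mkℚᵘ (+ c) d′   ≡⟨ cong (λ z → mkℚᵘ z _) (cong₂ ℤ._+_ (sym (ℤ.pos-* a d)) (sym (ℤ.pos-* c b))) ⟩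
    mkℚᵘ (+ (a * d ℕ.+ c * b)) _       ≈⟨ ℚᵘ.≃-sym (toℚᵘ-fromℚᵘ (mkℚᵘ (+ (a * d ℕ.+ c * b)) _)) ⟩
    toℚᵘ ((a * d ℕ.+ c * b) ÷ (b * d)) ∎)
    where open ℚᵘ.≃-Reasoning

-- The inequalities between the rational ratios

open import Data.Nat using (z≤n; s≤s; >-nonZero; NonZero)
open import Data.Nat.Properties using (*-comm; *-identityˡ; *-identityʳ; m*n≢0; m^n≢0; ≤-trans)
open import Data.Nat.Primality using (prime⇒nonZero)
open import Data.Product using (_,_)
open import Data.Rational using (_<_; _≤_; _+_; 0ℚ; 1ℚ)
open import Data.Rational.Properties using (_<?_)
open import Relation.Nullary.Decidable using (from-yes)
open import Relation.Binary.PropositionalEquality using (refl; sym; subst; subst₂)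
open NumberTheory using (oddPerfect-structure; module Bounds)
open Ratio

theorem4p2p3 : (N p k m : ℕ) → Prime p → 1 Data.Nat.≤ k → 1 Data.Nat.≤ m →
    p % 4 ≡ 1 → k % 4 ≡ 1 → gcd p m ≡ 1 →
    N ≡ p ^ k * (m * m) → N % 2 ≡ 1 → σ N ≡ 2 * N →
    (0ℚ < σ (p ^ k) ÷ (m * m)) × (σ (p ^ k) ÷ (m * m) ≤ 2 ÷ 3) × (2 ÷ 3 < 1ℚ)
    × (1ℚ < σ (p ^ k) ÷ (p ^ k)) × (σ (p ^ k) ÷ (p ^ k) < 5 ÷ 4) × (5 ÷ 4 < 8 ÷ 5)
    × (8 ÷ 5 < σ (m * m) ÷ (m * m)) × (σ (m * m) ÷ (m * m) < 2 ÷ 1) × (2 ÷ 1 < 3 ÷ 1)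
    × (3 ÷ 1 ≤ σ (m * m) ÷ (p ^ k))
    × (57 ÷ 20 < σ (p ^ k) ÷ (p ^ k) + σ (m * m) ÷ (m * m))
    × (σ (p ^ k) ÷ (p ^ k) + σ (m * m) ÷ (m * m) < 3 ÷ 1) × (3 ÷ 1 < 11 ÷ 3)
    × (11 ÷ 3 ≤ σ (p ^ k) ÷ (m * m) + σ (m * m) ÷ (p ^ k))
theorem4p2p3 _ p k m pp 1≤k 1≤m p%4 k%4 gcd≡1 refl odd perfect =
    -- `0ℚ` and, further down, `1ℚ` are met as `0 ÷ 1` and `1 ÷ 1`, to which they are equal by
    -- computation.
    ÷-mono-< 0 1 S M (subst (0 Data.Nat.<_) (sym (*-identityʳ S)) (≤-trans (s≤s z≤n) q<S))
  , ÷-mono-≤ S M 2 3 (subst (Data.Nat._≤ 2 * M) (*-comm 3 S) 3S≤2M)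
  , from-yes (2 ÷ 3 <? 1ℚ)
  , ÷-mono-< 1 1 S q (subst₂ Data.Nat._<_ (sym (*-identityˡ q)) (sym (*-identityʳ S)) q<S)
  , ÷-mono-< S q 5 4 (subst (Data.Nat._< 5 * q) (*-comm 4 S) 4S<5q)
  , from-yes (5 ÷ 4 <? 8 ÷ 5)
  , ÷-mono-< 8 5 T M (subst (8 * M Data.Nat.<_) (*-comm 5 T) 8M<5T)
  , ÷-mono-< T M 2 1 (subst (Data.Nat._< 2 * M) (sym (*-identityʳ T)) T<2M)
  , from-yes (2 ÷ 1 <? 3 ÷ 1)
  , ÷-mono-≤ 3 1 T q (subst (3 * q Data.Nat.≤_) (sym (*-identityʳ T)) 3q≤T)
  , subst (57 ÷ 20 <_) (sym (÷-+ S q T M))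
      (÷-mono-< 57 20 SM+Tq (q * M) (subst (57 * (q * M) Data.Nat.<_) (*-comm 20 SM+Tq) 57qM<20[SM+Tq]))
  , subst (_< 3 ÷ 1) (sym (÷-+ S q T M))
      (÷-mono-< SM+Tq (q * M) 3 1 (subst (Data.Nat._< 3 * (q * M)) (sym (*-identityʳ SM+Tq)) SM+Tq<3qM))
  , from-yes (3 ÷ 1 <? 11 ÷ 3)
  , subst (11 ÷ 3 ≤_) (sym (÷-+ S M T q))
      (÷-mono-≤ 11 3 Sq+TM (M * q) (subst (11 * (M * q) Data.Nat.≤_) (*-comm 3 Sq+TM) 11Mq≤3[Sq+TM]))
  where
  q = p ^ k
  M = m * m
  S = σ q
  T = σ M
  SM+Tq = S * M Data.Nat.+ T * q
  Sq+TM = S * q Data.Nat.+ T * M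
  instance
    p≢0 : NonZero p
    p≢0 = prime⇒nonZero pp
    m≢0 : NonZero m
    m≢0 = >-nonZero 1≤m
    q≢0 : NonZero q
    q≢0 = m^n≢0 p k
    M≢0 : NonZero M
    M≢0 = m*n≢0 m m
    qM≢0 : NonZero (q * M)
    qM≢0 = m*n≢0 q M
    Mq≢0 : NonZero (M * q)
    Mq≢0 = m*n≢0 M q
  open Bounds (oddPerfect-structure p k m pp 1≤k p%4 k%4 gcd≡1 odd perfect)
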